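{- Let $W$ be a finite irreducible Coxeter group of rank $n$ with degrees $d_1\le d_2\le\dots\le d_n$, and let $k$ be a positive integer. Then $$\mathrm{Cat}^{(k)}\{W\}=\prod_{j=1}^n\frac{\{d_j+kd_n\}}{\{d_j\}}$$ lies in $\mathbb{N}[s,t]$.
   Context: Let $s,t$ be variables; the Lucas polynomials are $\{0\}=0$, $\{1\}=1$, $\{m\}=s\{m-1\}+t\{m-2\}$ for $m\ge2$. $\mathbb{N}$ denotes the nonnegative integers. The finite irreducible Coxeter groups and their degrees (listed as a multiset; $d_n$ is the largest) are: $A_n$: $2,3,\dots,n+1$; $B_n$: $2,4,\dots,2n$; $D_n$: $2,4,\dots,2n-2,n$; $E_6$: $2,5,6,8,9,12$; $E_7$: $2,6,8,10,12,14,18$; $E_8$: $2,8,12,14,18,20,24,30$; $F_4$: $2,6,8,12$; $H_3$: $2,6,10$; $H_4$: $2,12,20,30$; $I_2(m)$: $2,m$. -}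

module Defs where

open import Data.Nat using (ℕ; zero; suc; _+_; _*_; _∸_; _≤_; _⊔_)
open import Data.List using (List; []; _∷_; map; foldr; upTo; _++_; length)

-- Polynomials in t with ℕ coefficients: coefficient lists, a₀ ∷ a₁ ∷ …
UPoly : Set
UPoly = List ℕ

_+ᵘ_ : UPoly → UPoly → UPoly
[] +ᵘ q = q
(a ∷ p) +ᵘ [] = a ∷ p
(a ∷ p) +ᵘ (b ∷ q) = (a + b) ∷ (p +ᵘ q)

scaleᵘ : ℕ → UPoly → UPoly
scaleᵘ a q = map (a *_) q

_*ᵘ_ : UPoly → UPoly → UPoly
[] *ᵘ q = []
(a ∷ p) *ᵘ q = scaleᵘ a q +ᵘ (0 ∷ (p *ᵘ q))

ucoeff : UPoly → ℕ → ℕ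
ucoeff [] j = 0
ucoeff (a ∷ p) zero = a
ucoeff (a ∷ p) (suc j) = ucoeff p j

-- Polynomials in ℕ[s,t]: list indexed by the power of s, each entry a
-- polynomial in t.  The coefficient of s^i t^j in p is  coeff p i j.
Poly : Set
Poly = List UPoly

_+ᵖ_ : Poly → Poly → Poly
[] +ᵖ q = q
(a ∷ p) +ᵖ [] = a ∷ p
(a ∷ p) +ᵖ (b ∷ q) = (a +ᵘ b) ∷ (p +ᵖ q)

scaleᵖ : UPoly → Poly → Poly
scaleᵖ a q = map (a *ᵘ_) q

_*ᵖ_ : Poly → Poly → Poly
[] *ᵖ q = []
(a ∷ p) *ᵖ q = scaleᵖ a q +ᵖ ([] ∷ (p *ᵖ q))

coeff : Poly → ℕ → ℕ → ℕ
coeff [] i j = 0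
coeff (a ∷ p) zero j = ucoeff a j
coeff (a ∷ p) (suc i) j = coeff p i j

_≈ᵖ_ : Poly → Poly → Set
p ≈ᵖ q = ∀ i j → coeff p i j ≡′ coeff q i j
  where open import Relation.Binary.PropositionalEquality renaming (_≡_ to _≡′_)

oneᵖ : Poly
oneᵖ = (1 ∷ []) ∷ []

mulS : Poly → Poly
mulS p = [] ∷ p

mulT : Poly → Poly
mulT p = map (0 ∷_) p

prodᵖ : List Poly → Poly
prodᵖ = foldr _*ᵖ_ oneᵖ

lucas : ℕ → Poly
lucas zero = []
lucas (suc zero) = oneᵖ
lucas (suc (suc m)) = mulS (lucas (suc m)) +ᵖ mulT (lucas m)

-- Finite irreducible Coxeter groups (Cartan–Killing types, with the
-- usual ranges of the parameters; I₂(m) requires m ≥ 3).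
data CoxeterType : Set where
  A  : (n : ℕ) → 1 ≤ n → CoxeterType
  B  : (n : ℕ) → 2 ≤ n → CoxeterType
  D  : (n : ℕ) → 4 ≤ n → CoxeterType
  E6 E7 E8 F4 H3 H4 : CoxeterType
  I₂ : (m : ℕ) → 3 ≤ m → CoxeterType

degrees : CoxeterType → List ℕ
degrees (A n _) = map (λ i → i + 2) (upTo n)
degrees (B n _) = map (λ i → 2 * (i + 1)) (upTo n)
degrees (D n _) = map (λ i → 2 * (i + 1)) (upTo (n ∸ 1)) ++ (n ∷ [])
degrees E6 = 2 ∷ 5 ∷ 6 ∷ 8 ∷ 9 ∷ 12 ∷ []
degrees E7 = 2 ∷ 6 ∷ 8 ∷ 10 ∷ 12 ∷ 14 ∷ 18 ∷ []
degrees E8 = 2 ∷ 8 ∷ 12 ∷ 14 ∷ 18 ∷ 20 ∷ 24 ∷ 30 ∷ []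
degrees F4 = 2 ∷ 6 ∷ 8 ∷ 12 ∷ []
degrees H3 = 2 ∷ 6 ∷ 10 ∷ []
degrees H4 = 2 ∷ 12 ∷ 20 ∷ 30 ∷ []
degrees (I₂ m _) = 2 ∷ m ∷ []

rank : CoxeterType → ℕ
rank W = length (degrees W)

maxDegree : CoxeterType → ℕ
maxDegree W = foldr _⊔_ 0 (degrees W)

catNum : CoxeterType → ℕ → Poly
catNum W k = prodᵖ (map (λ d → lucas (d + k * maxDegree W)) (degrees W))

catDen : CoxeterType → Poly
catDen W = prodᵖ (map lucas (degrees W))

{-# OPTIONS --safe #-}
-- The identity {m + n} = {m + 1}{n} + t{m}{n − 1} makes {g} divide {n} whenever g divides n, and
-- it is a Pascal recurrence for the Lucas analogues of the binomial coefficients, so these lie in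
-- ℕ[s,t]; the same holds for {d}, {2d}, {3d}, ….  Cat^(k){B_n} is such a coefficient, and for A_n,
-- D_n and I₂(m) one application of the identity to a factor of the numerator splits the numerator
-- into two multiples of the denominator.  For each other type with Coxeter number h there is an m
-- such that g_j = gcd(d_j + kh, mh) depends only on k mod m and ∏ {g_j} is already a multiple of
-- ∏ {d_j} with quotient in ℕ[s,t]: this is a finite computation, done at s = 1 because {n} is
-- homogeneous of degree n − 1 when s has degree 1 and t has degree 2.
module Submission where

open import Defs
open import Data.Nat using (ℕ; _≤_)
open import Data.Product using (∃)

open import Algebra using (CommutativeSemigroup; CommutativeSemiring; IsCommutativeMonoid; Op₂)
import Algebra.Definitions.RawMagma as RawMagma
import Algebra.Properties.CommutativeSemigroup as CommutativeSemigroupProperties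
import Algebra.Properties.CommutativeSemigroup.Divisibility as CommutativeSemigroupDivisibility
import Algebra.Properties.Semiring.Divisibility as SemiringDivisibility
import Algebra.Properties.Semiring.Exp as SemiringExp
import Algebra.Properties.Semiring.Mult as SemiringMult
import Algebra.Solver.Ring.NaturalCoefficients.Default as SemiringSolver
open import Algebra.Structures.Biased using (isCommutativeSemiringˡ)
open import Data.List using (List; []; _∷_; _++_; applyUpTo; drop; foldr; length; map; upTo)
open import Data.List.Membership.Propositional.Properties using (∈-upTo⁺)
open import Data.List.Properties using (foldr-++; map-applyUpTo; map-++; map-∘; map-upTo; ≡-dec)
open import Data.List.Relation.Unary.All as All using (All)
open import Data.Nat as ℕ using (NonZero; _∸_; _⊔_; pred; s≤s; suc; z≤n; zero)
import Data.Nat.Divisibility as ℕ∣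
open import Data.Nat.DivMod using (_%_; _/_; m%n<n; m≡m%n+[m/n]*n)
open import Data.Nat.GCD using (gcd; gcd[m,n]∣m; gcd[m,n]∣n)
open import Data.Nat.ListAction using (sum)
import Data.Nat.Properties as ℕₚ
open import Data.Nat.Tactic.RingSolver using (solve-∀)
open import Data.Product using (_×_; _,_; ∃₂)
open import Data.Sum using (_⊎_; inj₁; inj₂)
open import Function using (_∘_)
open import Relation.Binary.PropositionalEquality as ≡ using (_≡_)
import Relation.Binary.Reasoning.Setoid as SetoidReasoning
open import Relation.Binary.Structures using (IsEquivalence)
open import Relation.Nullary using (Dec; yes; no)
open import Relation.Nullary.Decidable using (True; map′; toWitness; _×-dec_)

open ℕ∣ using (divides)

-- Polynomials as coefficient lists form a commutative semiring.

record IsPolynomialArithmetic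
  {c ℓ} (R : CommutativeSemiring c ℓ) (_⊕_ _⊛_ : Op₂ (List (CommutativeSemiring.Carrier R))) : Set c where
  open CommutativeSemiring R
  field
    ⊕-[]ˡ : ∀ q → [] ⊕ q ≡ q
    ⊕-[]ʳ : ∀ a p → (a ∷ p) ⊕ [] ≡ a ∷ p
    ⊕-∷   : ∀ a p b q → (a ∷ p) ⊕ (b ∷ q) ≡ (a + b) ∷ (p ⊕ q)
    ⊛-[]  : ∀ q → [] ⊛ q ≡ []
    ⊛-∷   : ∀ a p q → (a ∷ p) ⊛ q ≡ map (a *_) q ⊕ (0# ∷ (p ⊛ q))

-- The given operations on ℕ[t] and on ℕ[s,t] are written out separately. Abstracting over their
-- defining equations lets one proof of the semiring laws serve both, the second instance taking the
-- first as its coefficients.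
module ListPolynomial
  {c ℓ} (R : CommutativeSemiring c ℓ) (_⊕_ _⊛_ : Op₂ (List (CommutativeSemiring.Carrier R)))
  (isPolynomialArithmetic : IsPolynomialArithmetic R _⊕_ _⊛_)
  where

  open CommutativeSemiring R
  open IsPolynomialArithmetic isPolynomialArithmetic
  open SetoidReasoning setoid

  coefficient : List Carrier → ℕ → Carrier
  coefficient []      i       = 0#
  coefficient (a ∷ p) zero    = a
  coefficient (a ∷ p) (suc i) = coefficient p i

  -- A record, so that both polynomials can be inferred from a proof.
  record _≋_ (p q : List Carrier) : Set ℓ where
    constructor mk
    field at : ∀ i → coefficient p i ≈ coefficient q i
  open _≋_ public

  -- Equality `≋` is coefficientwise, so this reduces the laws of `⊕` to those of `R`. The laws of
  -- `⊛` go by induction on a list instead.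
  coefficient-⊕ : ∀ p q i → coefficient (p ⊕ q) i ≈ coefficient p i + coefficient q i
  coefficient-⊕ [] q i rewrite ⊕-[]ˡ q = sym (+-identityˡ _)
  coefficient-⊕ (a ∷ p) [] i rewrite ⊕-[]ʳ a p = sym (+-identityʳ _)
  coefficient-⊕ (a ∷ p) (b ∷ q) zero rewrite ⊕-∷ a p b q = refl
  coefficient-⊕ (a ∷ p) (b ∷ q) (suc i) rewrite ⊕-∷ a p b q = coefficient-⊕ p q i

  coefficient-scale : ∀ a q i → coefficient (map (a *_) q) i ≈ a * coefficient q i
  coefficient-scale a []      i       = sym (zeroʳ a)
  coefficient-scale a (b ∷ q) zero    = refl
  coefficient-scale a (b ∷ q) (suc i) = coefficient-scale a q i

  ≋-refl : ∀ {p} → p ≋ p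
  ≋-refl = mk λ i → refl

  ≋-sym : ∀ {p q} → p ≋ q → q ≋ p
  ≋-sym e = mk λ i → sym (at e i)

  ≋-trans : ∀ {p q r} → p ≋ q → q ≋ r → p ≋ r
  ≋-trans e f = mk λ i → trans (at e i) (at f i)

  ≋-reflexive : ∀ {p q} → p ≡ q → p ≋ q
  ≋-reflexive ≡.refl = ≋-refl

  ≋-isEquivalence : IsEquivalence _≋_
  ≋-isEquivalence = record { refl = ≋-refl ; sym = ≋-sym ; trans = ≋-trans }

  ⊕-cong : ∀ {p p′ q q′} → p ≋ p′ → q ≋ q′ → (p ⊕ q) ≋ (p′ ⊕ q′)
  ⊕-cong {p} {p′} {q} {q′} e f = mk λ i → begin
    coefficient (p ⊕ q) i                ≈⟨ coefficient-⊕ p q i ⟩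
    coefficient p i + coefficient q i    ≈⟨ +-cong (at e i) (at f i) ⟩
    coefficient p′ i + coefficient q′ i  ≈⟨ coefficient-⊕ p′ q′ i ⟨
    coefficient (p′ ⊕ q′) i              ∎

  ⊕-assoc : ∀ p q r → ((p ⊕ q) ⊕ r) ≋ (p ⊕ (q ⊕ r))
  ⊕-assoc p q r = mk λ i → begin
    coefficient ((p ⊕ q) ⊕ r) i
      ≈⟨ trans (coefficient-⊕ (p ⊕ q) r i) (+-congʳ (coefficient-⊕ p q i)) ⟩
    (coefficient p i + coefficient q i) + coefficient r i
      ≈⟨ +-assoc _ _ _ ⟩
    coefficient p i + (coefficient q i + coefficient r i)
      ≈⟨ trans (coefficient-⊕ p (q ⊕ r) i) (+-congˡ (coefficient-⊕ q r i)) ⟨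
    coefficient (p ⊕ (q ⊕ r)) i ∎

  ⊕-comm : ∀ p q → (p ⊕ q) ≋ (q ⊕ p)
  ⊕-comm p q = mk λ i →
    trans (coefficient-⊕ p q i) (trans (+-comm _ _) (sym (coefficient-⊕ q p i)))

  ⊕-identityˡ : ∀ p → ([] ⊕ p) ≋ p
  ⊕-identityˡ p = ≋-reflexive (⊕-[]ˡ p)

  ⊕-identityʳ : ∀ p → (p ⊕ []) ≋ p
  ⊕-identityʳ p = ≋-trans (⊕-comm p []) (⊕-identityˡ p)

  ⊕-isCommutativeMonoid : IsCommutativeMonoid _≋_ _⊕_ []
  ⊕-isCommutativeMonoid = record
    { isMonoid = record
      { isSemigroup = record
        { isMagma = record { isEquivalence = ≋-isEquivalence ; ∙-cong = ⊕-cong }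
        ; assoc = ⊕-assoc
        }
      ; identity = ⊕-identityˡ , ⊕-identityʳ
      }
    ; comm = ⊕-comm
    }

  ⊕-commutativeSemigroup : CommutativeSemigroup c ℓ
  ⊕-commutativeSemigroup = record
    { isCommutativeSemigroup = IsCommutativeMonoid.isCommutativeSemigroup ⊕-isCommutativeMonoid }

  private
    module ⊕ = CommutativeSemigroupProperties ⊕-commutativeSemigroup

  ∷-cong : ∀ {a b p q} → a ≈ b → p ≋ q → (a ∷ p) ≋ (b ∷ q)
  ∷-cong a≈b e = mk λ { zero → a≈b ; (suc i) → at e i }

  0∷[]≋[] : (0# ∷ []) ≋ []
  0∷[]≋[] = mk λ { zero → refl ; (suc i) → refl }

  0∷-⊕ : ∀ p q → (0# ∷ (p ⊕ q)) ≋ ((0# ∷ p) ⊕ (0# ∷ q))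
  0∷-⊕ p q = ≋-trans (∷-cong (sym (+-identityˡ 0#)) ≋-refl) (≋-reflexive (≡.sym (⊕-∷ 0# p 0# q)))

  scale : Carrier → List Carrier → List Carrier
  scale a = map (a *_)

  scale-cong : ∀ a {p q} → p ≋ q → scale a p ≋ scale a q
  scale-cong a {p} {q} e = mk λ i →
    trans (coefficient-scale a p i) (trans (*-congˡ (at e i)) (sym (coefficient-scale a q i)))

  scale-⊕ : ∀ a p q → scale a (p ⊕ q) ≋ (scale a p ⊕ scale a q)
  scale-⊕ a p q = mk λ i → begin
    coefficient (scale a (p ⊕ q)) i
      ≈⟨ trans (coefficient-scale a (p ⊕ q) i) (*-congˡ (coefficient-⊕ p q i)) ⟩
    a * (coefficient p i + coefficient q i)
      ≈⟨ distribˡ a _ _ ⟩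
    a * coefficient p i + a * coefficient q i
      ≈⟨ +-cong (coefficient-scale a p i) (coefficient-scale a q i) ⟨
    coefficient (scale a p) i + coefficient (scale a q) i
      ≈⟨ coefficient-⊕ (scale a p) (scale a q) i ⟨
    coefficient (scale a p ⊕ scale a q) i ∎

  scale-scale : ∀ a b p → scale (a * b) p ≋ scale a (scale b p)
  scale-scale a b p = mk λ i → begin
    coefficient (scale (a * b) p) i    ≈⟨ coefficient-scale (a * b) p i ⟩
    (a * b) * coefficient p i          ≈⟨ *-assoc a b _ ⟩
    a * (b * coefficient p i)          ≈⟨ *-congˡ (coefficient-scale b p i) ⟨
    a * coefficient (scale b p) i      ≈⟨ coefficient-scale a (scale b p) i ⟨
    coefficient (scale a (scale b p)) i ∎

  scale-0 : ∀ p → scale 0# p ≋ []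
  scale-0 p = mk λ i → trans (coefficient-scale 0# p i) (zeroˡ _)

  scale-1 : ∀ p → scale 1# p ≋ p
  scale-1 p = mk λ i → trans (coefficient-scale 1# p i) (*-identityˡ _)

  ∷-⊛ : ∀ a p q → ((a ∷ p) ⊛ q) ≋ (scale a q ⊕ (0# ∷ (p ⊛ q)))
  ∷-⊛ a p q = ≋-reflexive (⊛-∷ a p q)

  0∷-⊛ : ∀ p q → ((0# ∷ p) ⊛ q) ≋ (0# ∷ (p ⊛ q))
  0∷-⊛ p q = ≋-trans (∷-⊛ 0# p q) (≋-trans (⊕-cong (scale-0 q) ≋-refl) (⊕-identityˡ _))

  ⊛-zeroˡ : ∀ q → ([] ⊛ q) ≋ []
  ⊛-zeroˡ q = ≋-reflexive (⊛-[] q)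

  ⊛-zeroʳ : ∀ p → (p ⊛ []) ≋ []
  ⊛-zeroʳ []      = ⊛-zeroˡ []
  ⊛-zeroʳ (a ∷ p) = ≋-trans (∷-⊛ a p [])
    (≋-trans (⊕-identityˡ _) (≋-trans (∷-cong refl (⊛-zeroʳ p)) 0∷[]≋[]))

  -- The mirror image of `∷-⊛`: the definition recurses on the left factor only, and comparing the
  -- two expansions gives commutativity by induction.
  ⊛-∷ʳ : ∀ p b q → (p ⊛ (b ∷ q)) ≋ (scale b p ⊕ (0# ∷ (p ⊛ q)))
  ⊛-∷ʳ [] b q = ≋-trans (⊛-zeroˡ _) (≋-sym
    (≋-trans (⊕-identityˡ _) (≋-trans (∷-cong refl (⊛-zeroˡ q)) 0∷[]≋[])))
  ⊛-∷ʳ (a ∷ p) b q = ≋-trans (∷-⊛ a p (b ∷ q)) (≋-trans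
    (⊕-cong {scale a (b ∷ q)} ≋-refl (∷-cong refl (⊛-∷ʳ p b q)))
    -- With both factors expanded, the constant terms differ by commutativity in `R`, and the
    -- remaining coefficients by exchanging the summands `u` and `v`.
    (≋-trans (mk λ { zero → head ; (suc i) → tail i })
      (⊕-cong {scale b (a ∷ p)} ≋-refl (∷-cong refl (≋-sym (∷-⊛ a p q))))))
    where
    u = scale a q
    v = scale b p
    w = 0# ∷ (p ⊛ q)
    step : ∀ a p b q → coefficient ((a ∷ p) ⊕ (b ∷ q)) 0 ≈ a + b
    step a p b q = coefficient-⊕ (a ∷ p) (b ∷ q) 0
    head : coefficient ((a * b ∷ u) ⊕ (0# ∷ (v ⊕ w))) 0 ≈ coefficient ((b * a ∷ v) ⊕ (0# ∷ (u ⊕ w))) 0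
    head = trans (step _ u _ (v ⊕ w)) (trans (+-congʳ (*-comm a b)) (sym (step _ v _ (u ⊕ w))))
    tail : ∀ i → coefficient ((a * b ∷ u) ⊕ (0# ∷ (v ⊕ w))) (suc i)
               ≈ coefficient ((b * a ∷ v) ⊕ (0# ∷ (u ⊕ w))) (suc i)
    tail i = begin
      coefficient ((a * b ∷ u) ⊕ (0# ∷ (v ⊕ w))) (suc i)
        ≈⟨ coefficient-⊕ (a * b ∷ u) (0# ∷ (v ⊕ w)) (suc i) ⟩
      coefficient u i + coefficient (v ⊕ w) i
        ≈⟨ coefficient-⊕ u (v ⊕ w) i ⟨
      coefficient (u ⊕ (v ⊕ w)) i
        ≈⟨ at (⊕.x∙yz≈y∙xz u v w) i ⟩
      coefficient (v ⊕ (u ⊕ w)) i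
        ≈⟨ coefficient-⊕ v (u ⊕ w) i ⟩
      coefficient v i + coefficient (u ⊕ w) i
        ≈⟨ coefficient-⊕ (b * a ∷ v) (0# ∷ (u ⊕ w)) (suc i) ⟨
      coefficient ((b * a ∷ v) ⊕ (0# ∷ (u ⊕ w))) (suc i) ∎

  ⊛-comm : ∀ p q → (p ⊛ q) ≋ (q ⊛ p)
  ⊛-comm []      q = ≋-trans (⊛-zeroˡ q) (≋-sym (⊛-zeroʳ q))
  ⊛-comm (a ∷ p) q = ≋-trans (∷-⊛ a p q) (≋-trans
    (⊕-cong {scale a q} ≋-refl (∷-cong refl (⊛-comm p q))) (≋-sym (⊛-∷ʳ q a p)))

  ⊛-congˡ : ∀ p {q r} → q ≋ r → (p ⊛ q) ≋ (p ⊛ r)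
  ⊛-congˡ []      {q} {r} e = ≋-trans (⊛-zeroˡ q) (≋-sym (⊛-zeroˡ r))
  ⊛-congˡ (a ∷ p) {q} {r} e = ≋-trans (∷-⊛ a p q) (≋-trans
    (⊕-cong (scale-cong a e) (∷-cong refl (⊛-congˡ p e))) (≋-sym (∷-⊛ a p r)))

  ⊛-congʳ : ∀ r {p q} → p ≋ q → (p ⊛ r) ≋ (q ⊛ r)
  ⊛-congʳ r {p} {q} e = ≋-trans (⊛-comm p r) (≋-trans (⊛-congˡ r e) (⊛-comm r q))

  ⊛-cong : ∀ {p p′ q q′} → p ≋ p′ → q ≋ q′ → (p ⊛ q) ≋ (p′ ⊛ q′)
  ⊛-cong {p′ = p′} {q} e f = ≋-trans (⊛-congʳ q e) (⊛-congˡ p′ f)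

  ⊛-distribˡ : ∀ p q r → (p ⊛ (q ⊕ r)) ≋ ((p ⊛ q) ⊕ (p ⊛ r))
  ⊛-distribˡ [] q r = ≋-trans (⊛-zeroˡ _) (≋-sym
    (≋-trans (⊕-cong (⊛-zeroˡ q) (⊛-zeroˡ r)) (⊕-identityˡ [])))
  ⊛-distribˡ (a ∷ p) q r = ≋-trans (∷-⊛ a p (q ⊕ r)) (≋-trans
    (⊕-cong (scale-⊕ a q r) (≋-trans (∷-cong refl (⊛-distribˡ p q r)) (0∷-⊕ _ _)))
    (≋-trans (⊕.interchange (scale a q) (scale a r) (0# ∷ (p ⊛ q)) (0# ∷ (p ⊛ r)))
      (⊕-cong (≋-sym (∷-⊛ a p q)) (≋-sym (∷-⊛ a p r)))))

  ⊛-distribʳ : ∀ r p q → ((p ⊕ q) ⊛ r) ≋ ((p ⊛ r) ⊕ (q ⊛ r))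
  ⊛-distribʳ r p q = ≋-trans (⊛-comm (p ⊕ q) r)
    (≋-trans (⊛-distribˡ r p q) (⊕-cong (⊛-comm r p) (⊛-comm r q)))

  scale-⊛ : ∀ a p q → (scale a p ⊛ q) ≋ scale a (p ⊛ q)
  scale-⊛ a [] q = ≋-trans (⊛-zeroˡ q) (scale-cong a (≋-sym (⊛-zeroˡ q)))
  scale-⊛ a (b ∷ p) q = ≋-trans (∷-⊛ (a * b) (scale a p) q) (≋-trans
    (⊕-cong (scale-scale a b q) (∷-cong (sym (zeroʳ a)) (scale-⊛ a p q)))
    (≋-trans (≋-sym (scale-⊕ a (scale b q) (0# ∷ (p ⊛ q)))) (scale-cong a (≋-sym (∷-⊛ b p q)))))

  ⊛-assoc : ∀ p q r → ((p ⊛ q) ⊛ r) ≋ (p ⊛ (q ⊛ r))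
  ⊛-assoc [] q r = ≋-trans (⊛-congʳ r (⊛-zeroˡ q)) (≋-trans (⊛-zeroˡ r) (≋-sym (⊛-zeroˡ _)))
  ⊛-assoc (a ∷ p) q r = ≋-trans (⊛-congʳ r (∷-⊛ a p q)) (≋-trans
    (⊛-distribʳ r (scale a q) (0# ∷ (p ⊛ q)))
    (≋-trans
      (⊕-cong (scale-⊛ a q r) (≋-trans (0∷-⊛ (p ⊛ q) r) (∷-cong refl (⊛-assoc p q r))))
      (≋-sym (∷-⊛ a p (q ⊛ r)))))

  ⊛-identityˡ : ∀ q → ((1# ∷ []) ⊛ q) ≋ q
  ⊛-identityˡ q = ≋-trans (∷-⊛ 1# [] q) (≋-trans
    (⊕-cong (scale-1 q) (≋-trans (∷-cong refl (⊛-zeroˡ q)) 0∷[]≋[])) (⊕-identityʳ q))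

  ⊛-identityʳ : ∀ q → (q ⊛ (1# ∷ [])) ≋ q
  ⊛-identityʳ q = ≋-trans (⊛-comm q _) (⊛-identityˡ q)

  ⊛-isCommutativeMonoid : IsCommutativeMonoid _≋_ _⊛_ (1# ∷ [])
  ⊛-isCommutativeMonoid = record
    { isMonoid = record
      { isSemigroup = record
        { isMagma = record { isEquivalence = ≋-isEquivalence ; ∙-cong = ⊛-cong }
        ; assoc = ⊛-assoc
        }
      ; identity = ⊛-identityˡ , ⊛-identityʳ
      }
    ; comm = ⊛-comm
    }

  commutativeSemiring : CommutativeSemiring c ℓ
  commutativeSemiring = record
    { isCommutativeSemiring = isCommutativeSemiringˡ record
      { +-isCommutativeMonoid = ⊕-isCommutativeMonoid
      ; *-isCommutativeMonoid = ⊛-isCommutativeMonoid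
      ; distribʳ = ⊛-distribʳ
      ; zeroˡ = ⊛-zeroˡ
      }
    }

-- The semirings ℕ[t] and ℕ[s,t].

+ᵘ-*ᵘ-isPolynomialArithmetic : IsPolynomialArithmetic ℕₚ.+-*-commutativeSemiring _+ᵘ_ _*ᵘ_
+ᵘ-*ᵘ-isPolynomialArithmetic = record
  { ⊕-[]ˡ = λ _ → ≡.refl
  ; ⊕-[]ʳ = λ _ _ → ≡.refl
  ; ⊕-∷   = λ _ _ _ _ → ≡.refl
  ; ⊛-[]  = λ _ → ≡.refl
  ; ⊛-∷   = λ _ _ _ → ≡.refl
  }

module ℕ[t] = ListPolynomial ℕₚ.+-*-commutativeSemiring _+ᵘ_ _*ᵘ_ +ᵘ-*ᵘ-isPolynomialArithmetic

+ᵖ-*ᵖ-isPolynomialArithmetic : IsPolynomialArithmetic ℕ[t].commutativeSemiring _+ᵖ_ _*ᵖ_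
+ᵖ-*ᵖ-isPolynomialArithmetic = record
  { ⊕-[]ˡ = λ _ → ≡.refl
  ; ⊕-[]ʳ = λ _ _ → ≡.refl
  ; ⊕-∷   = λ _ _ _ _ → ≡.refl
  ; ⊛-[]  = λ _ → ≡.refl
  ; ⊛-∷   = λ _ _ _ → ≡.refl
  }

module ℕ[s,t] = ListPolynomial ℕ[t].commutativeSemiring _+ᵖ_ _*ᵖ_ +ᵖ-*ᵖ-isPolynomialArithmetic

ucoeff-coefficient : ∀ p j → ucoeff p j ≡ ℕ[t].coefficient p j
ucoeff-coefficient []      j       = ≡.refl
ucoeff-coefficient (a ∷ p) zero    = ≡.refl
ucoeff-coefficient (a ∷ p) (suc j) = ucoeff-coefficient p j

coeff-coefficient : ∀ p i j → coeff p i j ≡ ℕ[t].coefficient (ℕ[s,t].coefficient p i) j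
coeff-coefficient []      i       j = ≡.refl
coeff-coefficient (a ∷ p) zero    j = ucoeff-coefficient a j
coeff-coefficient (a ∷ p) (suc i) j = coeff-coefficient p i j

≋⇒≈ᵖ : ∀ {p q} → p ℕ[s,t].≋ q → p ≈ᵖ q
≋⇒≈ᵖ {p} {q} e i j = ≡.trans (coeff-coefficient p i j)
  (≡.trans (ℕ[t].at (ℕ[s,t].at e i) j) (≡.sym (coeff-coefficient q i j)))

𝐬 𝐭 : Poly
𝐬 = [] ∷ (1 ∷ []) ∷ []
𝐭 = (0 ∷ 1 ∷ []) ∷ []

mulS≋𝐬* : ∀ p → mulS p ℕ[s,t].≋ (𝐬 *ᵖ p)
mulS≋𝐬* p = ℕ[s,t].≋-sym (ℕ[s,t].≋-trans (ℕ[s,t].0∷-⊛ ((1 ∷ []) ∷ []) p)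
  (ℕ[s,t].∷-cong ℕ[t].≋-refl (ℕ[s,t].⊛-identityˡ p)))

mulT≋𝐭* : ∀ p → mulT p ℕ[s,t].≋ (𝐭 *ᵖ p)
mulT≋𝐭* p = ℕ[s,t].≋-sym (ℕ[s,t].≋-trans
  (ℕ[s,t].⊕-cong {scaleᵖ (0 ∷ 1 ∷ []) p} ℕ[s,t].≋-refl ℕ[s,t].0∷[]≋[])
  (ℕ[s,t].≋-trans (ℕ[s,t].⊕-identityʳ _) (t* p)))
  where
  t* : ∀ p → scaleᵖ (0 ∷ 1 ∷ []) p ℕ[s,t].≋ mulT p
  t* []      = ℕ[s,t].≋-refl
  t* (a ∷ p) = ℕ[s,t].∷-cong (ℕ[t].≋-trans (ℕ[t].0∷-⊛ (1 ∷ []) a)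
    (ℕ[t].∷-cong ≡.refl (ℕ[t].⊛-identityˡ a))) (t* p)

-- Forms in s and t, evaluated at s = 1, and certificates of divisibility.

-- A list a₀ ∷ a₁ ∷ … fits degree n when it encodes a form Σ aᵢ s^(n − 2i) t^i, i.e. all exponents are ≥ 0.
data Fits : ℕ → UPoly → Set where
  []   : ∀ {n} → Fits n []
  [-]  : ∀ {n a} → Fits n (a ∷ [])
  _∷_  : ∀ {n p} a → Fits n p → Fits (2 ℕ.+ n) (a ∷ p)

fits? : ∀ n p → Dec (Fits n p)
fits? n [] = yes []
fits? n (a ∷ []) = yes [-]
fits? zero (a ∷ b ∷ p) = no λ ()
fits? (suc zero) (a ∷ b ∷ p) = no λ ()
fits? (suc (suc n)) (a ∷ b ∷ p) = map′ (a ∷_) (λ { (_ ∷ f) → f }) (fits? n (b ∷ p))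

fits-suc : ∀ {n p} → Fits n p → Fits (suc n) p
fits-suc []      = []
fits-suc [-]     = [-]
fits-suc (a ∷ f) = a ∷ fits-suc f

fits-mono : ∀ m {n p} → Fits n p → Fits (m ℕ.+ n) p
fits-mono zero    f = f
fits-mono (suc m) f = fits-suc (fits-mono m f)

fits-+ : ∀ {n p q} → Fits n p → Fits n q → Fits n (p +ᵘ q)
fits-+ []      g       = g
fits-+ [-]     []      = [-]
fits-+ [-]     [-]     = [-]
fits-+ [-]     (b ∷ g) = _ ∷ g
fits-+ (a ∷ f) []      = a ∷ f
fits-+ {p = _ ∷ []}    (a ∷ f) [-] = [-]
fits-+ {p = _ ∷ _ ∷ _} (a ∷ f) [-] = _ ∷ f
fits-+ (a ∷ f) (b ∷ g) = _ ∷ fits-+ f g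

fits-scale : ∀ {n p} a → Fits n p → Fits n (scaleᵘ a p)
fits-scale a []      = []
fits-scale a [-]     = [-]
fits-scale a (b ∷ f) = _ ∷ fits-scale a f

fits-* : ∀ {m n p q} → Fits m p → Fits n q → Fits (m ℕ.+ n) (p *ᵘ q)
fits-* []  g = []
-- Multiplication by a one-entry list leaves the summand `0 ∷ []`, which fits every degree.
fits-* {m} ([-] {a = a}) g = fits-+ (fits-mono m (fits-scale a g)) [-]
fits-* {suc (suc m)} (a ∷ f) g = fits-+ (fits-mono (suc (suc m)) (fits-scale a g)) (0 ∷ fits-* f g)

-- {n} at s = 1
lucas₁ : ℕ → UPoly
lucas₁ zero          = []
lucas₁ (suc zero)    = 1 ∷ []
lucas₁ (suc (suc n)) = lucas₁ (suc n) +ᵘ (0 ∷ lucas₁ n)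

-- The degree of {n} is n - 1; at n = 0 the truncated value does no harm, because `lucas₁ 0` is the
-- empty list.
fits-lucas₁ : ∀ n → Fits (pred n) (lucas₁ n)
fits-lucas₁ zero                = []
fits-lucas₁ (suc zero)          = [-]
fits-lucas₁ (suc (suc zero))    = [-]
fits-lucas₁ (suc (suc (suc n))) = fits-+ (fits-suc (fits-lucas₁ (suc (suc n)))) (0 ∷ fits-lucas₁ (suc n))

-- Carries two consecutive terms along, so that evaluating certificates avoids the double recursion
-- of `lucas₁`.
lucasFrom : ℕ → UPoly → UPoly → UPoly
lucasFrom zero    p q = p
lucasFrom (suc n) p q = lucasFrom n q (q +ᵘ (0 ∷ p))

lucasFrom-lucas₁ : ∀ n m → lucasFrom n (lucas₁ m) (lucas₁ (suc m)) ≡ lucas₁ (n ℕ.+ m)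
lucasFrom-lucas₁ zero    m = ≡.refl
lucasFrom-lucas₁ (suc n) m = ≡.trans (lucasFrom-lucas₁ n (suc m)) (≡.cong lucas₁ (ℕₚ.+-suc n m))

lucasFrom-0 : ∀ n → lucasFrom n [] (1 ∷ []) ≡ lucas₁ n
lucasFrom-0 n = ≡.trans (lucasFrom-lucas₁ n 0) (≡.cong lucas₁ (ℕₚ.+-identityʳ n))

lucasProduct₁ : List ℕ → UPoly
lucasProduct₁ = foldr (λ n p → lucasFrom n [] (1 ∷ []) *ᵘ p) (1 ∷ [])

degree : List ℕ → ℕ
degree ns = sum (map pred ns)

fits-lucasProduct₁ : ∀ ns → Fits (degree ns) (lucasProduct₁ ns)
fits-lucasProduct₁ []       = [-]
fits-lucasProduct₁ (n ∷ ns) rewrite lucasFrom-0 n = fits-* (fits-lucas₁ n) (fits-lucasProduct₁ ns)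

infixl 6 _⊖_
_⊖_ : UPoly → UPoly → UPoly
[]      ⊖ q       = []
(a ∷ p) ⊖ []      = a ∷ p
(a ∷ p) ⊖ (b ∷ q) = (a ∸ b) ∷ (p ⊖ q)

-- The first n coefficients of p / d, for d with constant coefficient 1.  The truncated
-- subtraction is exact whenever p is a multiple of d in ℕ[t].
divide : ℕ → UPoly → UPoly → UPoly
divide zero    p       d = []
divide (suc n) []      d = []
divide (suc n) (a ∷ p) d = a ∷ divide n (p ⊖ scaleᵘ a (drop 1 d)) d

-- The lengths of nonempty factors add up to one more than the length of their product, which tells
-- how many coefficients to compute. No correctness proof accompanies the division: `Factorisation`
-- multiplies back and compares.
quotient : UPoly → UPoly → UPoly
quotient p d = divide (suc (length p) ∸ length d) p d

-- In `Certificate`, `k` is a truncated difference of degrees; the first component certifies that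
-- nothing was truncated.
Factorisation : (k m n : ℕ) (q d p : UPoly) → Set
Factorisation k m n q d p = (k ℕ.+ m ≡ n) × Fits k q × (q *ᵘ d ≡ p)

factorisation? : ∀ k m n q d p → Dec (Factorisation k m n q d p)
factorisation? k m n q d p = (k ℕ.+ m ℕₚ.≟ n) ×-dec fits? k q ×-dec ≡-dec ℕₚ._≟_ (q *ᵘ d) p

Certificate : List ℕ → List ℕ → Set
Certificate ds ns =
  Factorisation (degree ns ∸ degree ds) (degree ds) (degree ns)
    (quotient (lucasProduct₁ ns) (lucasProduct₁ ds)) (lucasProduct₁ ds) (lucasProduct₁ ns)

certificate? : ∀ ds ns → Dec (Certificate ds ns)
certificate? ds ns = factorisation? _ _ _ _ _ _

commonDivisors : List ℕ → ℕ → ℕ → ℕ → List ℕ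
commonDivisors ds h m r = map (λ d → gcd (d ℕ.+ r ℕ.* h) (m ℕ.* h)) ds

CertifiedModulo : List ℕ → ℕ → ℕ → Set
CertifiedModulo ds h m = All (λ r → Certificate ds (commonDivisors ds h m r)) (upTo m)

certifiedModulo? : ∀ ds h m → Dec (CertifiedModulo ds h m)
certifiedModulo? ds h m = All.all? (λ r → certificate? ds (commonDivisors ds h m r)) (upTo m)

-- The largest degree in the families A, B, D and I₂.

-- The starting value `e` is 0 for types A and B. For type D it is the extra degree at the end of
-- the list, which `foldr-++` turns into a starting value.
foldr-⊔-applyUpTo : ∀ f e n → (∀ {i j} → i ≤ j → f i ≤ f j) → e ≤ f n →
  foldr _⊔_ e (applyUpTo f (suc n)) ≡ f n
foldr-⊔-applyUpTo f e zero    mono e≤ = ℕₚ.m≥n⇒m⊔n≡m e≤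
foldr-⊔-applyUpTo f e (suc n) mono e≤ = ≡.trans
  (≡.cong (f 0 ⊔_) (foldr-⊔-applyUpTo (f ∘ suc) e n (mono ∘ s≤s) e≤)) (ℕₚ.m≤n⇒m⊔n≡n (mono z≤n))

foldr-⊔-map-upTo : ∀ f e n → (∀ {i j} → i ≤ j → f i ≤ f j) → e ≤ f n →
  foldr _⊔_ e (map f (upTo (suc n))) ≡ f n
foldr-⊔-map-upTo f e n mono e≤ =
  ≡.trans (≡.cong (foldr _⊔_ e) (map-upTo f (suc n))) (foldr-⊔-applyUpTo f e n mono e≤)

2[i+1]-mono : ∀ {i j} → i ≤ j → 2 ℕ.* (i ℕ.+ 1) ≤ 2 ℕ.* (j ℕ.+ 1)
2[i+1]-mono i≤j = ℕₚ.*-monoʳ-≤ 2 (ℕₚ.+-monoˡ-≤ 1 i≤j)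

maxDegree-A : ∀ n {1≤n} → maxDegree (A (suc n) 1≤n) ≡ suc (suc n)
maxDegree-A n = ≡.trans (foldr-⊔-map-upTo (ℕ._+ 2) 0 n (ℕₚ.+-monoˡ-≤ 2) z≤n) (ℕₚ.+-comm n 2)

maxDegree-B : ∀ n {2≤n} → maxDegree (B (suc n) 2≤n) ≡ 2 ℕ.* suc n
maxDegree-B n = ≡.trans (foldr-⊔-map-upTo (λ i → 2 ℕ.* (i ℕ.+ 1)) 0 n 2[i+1]-mono z≤n)
  (≡.cong (2 ℕ.*_) (ℕₚ.+-comm n 1))

maxDegree-D : ∀ n {4≤n} → maxDegree (D (suc (suc n)) 4≤n) ≡ 2 ℕ.* suc n
maxDegree-D n = ≡.trans
  (foldr-++ _⊔_ 0 (map (λ i → 2 ℕ.* (i ℕ.+ 1)) (upTo (suc n))) (suc (suc n) ∷ []))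
  (≡.trans
    (foldr-⊔-map-upTo (λ i → 2 ℕ.* (i ℕ.+ 1)) (suc (suc n)) n 2[i+1]-mono 2+n≤2[n+1])
    (≡.cong (2 ℕ.*_) (ℕₚ.+-comm n 1)))
  where
  double : ∀ n → 2 ℕ.+ n ℕ.+ n ≡ 2 ℕ.* (n ℕ.+ 1)
  double = solve-∀
  2+n≤2[n+1] : 2 ℕ.+ n ≤ 2 ℕ.* (n ℕ.+ 1)
  2+n≤2[n+1] = ≡.subst (2 ℕ.+ n ≤_) (double n) (ℕₚ.m≤m+n (2 ℕ.+ n) n)

maxDegree-I₂ : ∀ {m} (3≤m : 3 ≤ m) → maxDegree (I₂ m 3≤m) ≡ m
maxDegree-I₂ {m} 3≤m = ≡.trans (≡.cong (2 ⊔_) (ℕₚ.⊔-identityʳ m)) (ℕₚ.m≤n⇒m⊔n≡n (ℕₚ.<⇒≤ 3≤m))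

-- Divisibility in Lucas sequences over a commutative semiring.

record IsLucasSequence
  {c ℓ} (R : CommutativeSemiring c ℓ) (s t : CommutativeSemiring.Carrier R)
  (L : ℕ → CommutativeSemiring.Carrier R) : Set ℓ where
  open CommutativeSemiring R
  field
    L-0   : L 0 ≈ 0#
    L-1   : L 1 ≈ 1#
    L-rec : ∀ n → L (2 ℕ.+ n) ≈ s * L (suc n) + t * L n

-- A divisibility `x ∣ y` provides a cofactor inside the semiring, so over ℕ[s,t] it already
-- contains the nonnegativity of the quotient's coefficients.
module LucasSequence
  {c ℓ} (R : CommutativeSemiring c ℓ) (s t : CommutativeSemiring.Carrier R)
  (L : ℕ → CommutativeSemiring.Carrier R) (isLucasSequence : IsLucasSequence R s t L)
  where

  open CommutativeSemiring R
  open IsLucasSequence isLucasSequence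
  open SetoidReasoning setoid
  open SemiringSolver R using (solve; _:=_; _:+_; _:*_; con)
  open CommutativeSemigroupDivisibility *-commutativeSemigroup
    using (_∣_; _,_; ∙-cong-∣; x∣ʳy⇒x∣ʳzy; ∣-respˡ-≈; ∣-respʳ-≈; ∣-trans)
  open SemiringDivisibility semiring using (∣-refl; ∣-reflexive)

  ∣-+ : ∀ {x y z} → x ∣ y → x ∣ z → x ∣ y + z
  ∣-+ (p , px≈y) (q , qx≈z) = p + q , trans (distribʳ _ p q) (+-cong px≈y qx≈z)

  -- Induction on `m` for all `n`: one unit moves from the first index to the second, the recurrence
  -- expands `L (2 + n)`, and the terms regroup into the recurrence for `L (2 + m)`.
  L-+ : ∀ m n → L (m ℕ.+ suc n) ≈ L (suc m) * L (suc n) + t * (L m * L n)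
  L-+ zero n = sym (begin
    L 1 * L (suc n) + t * (L 0 * L n)
      ≈⟨ +-cong (*-congʳ L-1) (*-congˡ (*-congʳ L-0)) ⟩
    1# * L (suc n) + t * (0# * L n)
      ≈⟨ solve 3 (λ x y z → con 1 :* x :+ z :* (con 0 :* y) := x) refl (L (suc n)) (L n) t ⟩
    L (suc n) ∎)
  L-+ (suc m) n = begin
    L (suc m ℕ.+ suc n)
      ≡⟨ ≡.cong L (ℕₚ.+-suc m (suc n)) ⟨
    L (m ℕ.+ suc (suc n))
      ≈⟨ L-+ m (suc n) ⟩
    L (suc m) * L (suc (suc n)) + t * (L m * L (suc n))
      ≈⟨ +-congʳ (*-congˡ (L-rec n)) ⟩
    L (suc m) * (s * L (suc n) + t * L n) + t * (L m * L (suc n))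
      ≈⟨ solve 6 (λ s t x y z w →
           x :* (s :* y :+ t :* z) :+ t :* (w :* y) :=
           (s :* x :+ t :* w) :* y :+ t :* (x :* z))
         refl s t (L (suc m)) (L (suc n)) (L n) (L m) ⟩
    (s * L (suc m) + t * L m) * L (suc n) + t * (L (suc m) * L n)
      ≈⟨ +-congʳ (*-congʳ (L-rec m)) ⟨
    L (suc (suc m)) * L (suc n) + t * (L (suc m) * L n) ∎

  -- Induction on the quotient c: `L-+` writes L((c + 1)g) as a multiple of L(g) plus a multiple of
  -- L(cg). As `L-+` takes a positive second index, g = 0 is treated apart.
  L-∣ : ∀ {g n} → g ℕ∣.∣ n → L g ∣ L n
  L-∣ {g} (divides c ≡.refl) = go g c
    where
    go : ∀ g c → L g ∣ L (c ℕ.* g)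
    go zero    c       = ∣-reflexive (reflexive (≡.cong L (≡.sym (ℕₚ.*-zeroʳ c))))
    go (suc g) zero    = 0# , trans (zeroˡ _) (sym L-0)
    go (suc g) (suc c) = ∣-respʳ-≈
      (trans (sym (L-+ (c ℕ.* suc g) g)) (reflexive (≡.cong L (ℕₚ.+-comm (c ℕ.* suc g) (suc g)))))
      (∣-+ (L (suc (c ℕ.* suc g)) , refl)
           (x∣ʳy⇒x∣ʳzy t (∣-trans (go (suc g) c) (L g , *-comm _ _))))

  -- Generalised binomial coefficients.

  Splitting : (ℕ → Carrier) → Set _
  Splitting a = ∀ m n → ∃₂ λ u v → a (m ℕ.+ n) ≈ u * a n + v * a m

  L-splitting : Splitting L
  L-splitting m zero = 0# , 1# , (begin
    L (m ℕ.+ 0)         ≡⟨ ≡.cong L (ℕₚ.+-identityʳ m) ⟩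
    L m                 ≈⟨ solve 2 (λ x y → x := con 0 :* y :+ con 1 :* x) refl (L m) (L 0) ⟩
    0# * L 0 + 1# * L m ∎)
  L-splitting m (suc n) = L (suc m) , t * L n , (begin
    L (m ℕ.+ suc n)                                ≈⟨ L-+ m n ⟩
    L (suc m) * L (suc n) + t * (L m * L n)
      ≈⟨ +-congˡ (solve 3 (λ t x y → t :* (x :* y) := t :* y :* x) refl t (L m) (L n)) ⟩
    L (suc m) * L (suc n) + t * L n * L m          ∎)

  -- Because `Splitting` leaves its coefficients unspecified, it passes to subsequences; d = 2
  -- serves the even degrees of types B and D.
  splitting-multiples : ∀ {a} d → Splitting a → Splitting (λ i → a (d ℕ.* i))
  splitting-multiples {a} d split m n with u , v , e ← split (d ℕ.* m) (d ℕ.* n) =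
    u , v , trans (reflexive (≡.cong a (ℕₚ.*-distribˡ-+ d m n))) e

  rising : (ℕ → Carrier) → ℕ → ℕ → Carrier
  rising a m zero    = 1#
  rising a m (suc n) = a m * rising a (suc m) n

  rising-last : ∀ a m n → rising a m (suc n) ≈ rising a m n * a (m ℕ.+ n)
  rising-last a m zero = trans (*-comm _ _) (*-congˡ (reflexive (≡.cong a (≡.sym (ℕₚ.+-identityʳ m)))))
  rising-last a m (suc n) = begin
    a m * rising a (suc m) (suc n)               ≈⟨ *-congˡ (rising-last a (suc m) n) ⟩
    a m * (rising a (suc m) n * a (suc m ℕ.+ n)) ≈⟨ *-assoc _ _ _ ⟨
    rising a m (suc n) * a (suc m ℕ.+ n)         ≡⟨ ≡.cong (λ i → rising a m (suc n) * a i) (ℕₚ.+-suc m n) ⟨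
    rising a m (suc n) * a (m ℕ.+ suc n)         ∎

  -- The quotients are the generalised binomial coefficients, and the splitting of the last
  -- factor a (m + n + 2) is their Pascal recurrence.
  rising-∣ : ∀ {a} → Splitting a → ∀ m n → rising a 1 n ∣ rising a (suc m) n
  rising-∣ split zero    n    = ∣-refl
  rising-∣ split (suc m) zero = ∣-refl
  rising-∣ {a} split (suc m) (suc n) with u , v , e ← split (suc m) (suc n) =
    ∣-respʳ-≈ (sym last)
      (∣-+ (x∣ʳy⇒x∣ʳzy u (∣-respˡ-≈ (sym (rising-last a 1 n))
              (∙-cong-∣ (rising-∣ split (suc m) n) ∣-refl)))
           (x∣ʳy⇒x∣ʳzy v (rising-∣ split m (suc n))))
    where
    r = rising a (suc (suc m)) n
    last : rising a (suc (suc m)) (suc n) ≈ u * (r * a (suc n)) + v * (a (suc m) * r)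
    last = begin
      rising a (suc (suc m)) (suc n)             ≈⟨ rising-last a (suc (suc m)) n ⟩
      r * a (suc (suc m) ℕ.+ n)                  ≡⟨ ≡.cong (λ i → r * a i) (ℕₚ.+-suc (suc m) n) ⟨
      r * a (suc m ℕ.+ suc n)                    ≈⟨ *-congˡ e ⟩
      r * (u * a (suc n) + v * a (suc m))
        ≈⟨ solve 5 (λ r u v x y → r :* (u :* x :+ v :* y) := u :* (r :* x) :+ v :* (y :* r))
             refl r u v (a (suc n)) (a (suc m)) ⟩
      u * (r * a (suc n)) + v * (a (suc m) * r)  ∎

  -- Products over the degrees, and the families A, B, D and I₂.

  product : List Carrier → Carrier
  product = foldr _*_ 1#

  product-applyUpTo : ∀ {f} a m n → (∀ i → f i ≈ a (m ℕ.+ i)) → product (applyUpTo f n) ≈ rising a m n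
  product-applyUpTo a m zero    e = refl
  product-applyUpTo a m (suc n) e = *-cong
    (trans (e 0) (reflexive (≡.cong a (ℕₚ.+-identityʳ m))))
    (product-applyUpTo a (suc m) n (λ i → trans (e (suc i)) (reflexive (≡.cong a (ℕₚ.+-suc m i)))))

  product-map-upTo : ∀ {A : Set} {g : A → Carrier} {f : ℕ → A} a m n →
    (∀ i → g (f i) ≡ a (m ℕ.+ i)) → product (map g (map f (upTo n))) ≈ rising a m n
  product-map-upTo {g = g} {f} a m n e = trans
    (reflexive (≡.cong product (≡.trans (≡.cong (map g) (map-upTo f n)) (map-applyUpTo f g n))))
    (product-applyUpTo a m n (reflexive ∘ e))

  product-∷ʳ : ∀ xs y → product (xs ++ y ∷ []) ≈ product xs * y
  product-∷ʳ []       y = *-comm y 1#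
  product-∷ʳ (x ∷ xs) y = trans (*-congˡ (product-∷ʳ xs y)) (sym (*-assoc x _ y))

  product-map-∷ʳ : ∀ {A : Set} (g : A → Carrier) xs y →
    product (map g (xs ++ y ∷ [])) ≈ product (map g xs) * g y
  product-map-∷ʳ g xs y = trans (reflexive (≡.cong product (map-++ g xs (y ∷ [])))) (product-∷ʳ (map g xs) (g y))

  product-∣ : ∀ {A : Set} {f g : A → Carrier} → (∀ x → f x ∣ g x) → ∀ xs → product (map f xs) ∣ product (map g xs)
  product-∣ f∣g []       = ∣-refl
  product-∣ f∣g (x ∷ xs) = ∙-cong-∣ (f∣g x) (product-∣ f∣g xs)

  -- The factor that is split is the last one, L(K + N), where N is the Coxeter number and K = kN.
  rising-∣-A : ∀ k n → rising L 2 (suc n) ∣ rising L (2 ℕ.+ k ℕ.* suc (suc n)) (suc n)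
  rising-∣-A k n = ∣-respˡ-≈ den (∣-respʳ-≈ (sym num)
    -- Here L(K + 1) joins `r` to form a run of n + 1 consecutive terms, a multiple of
    -- `rising L 1 (suc n)`; the factor L(N) completes the denominator.
    (∣-+ (∙-cong-∣ (rising-∣ L-splitting K (suc n)) ∣-refl)
         -- Here `r` covers the first n terms of the denominator, L(n + 1) is present, and L(N)
         -- divides L(K) because N divides K.
         (∣-respˡ-≈ (sym den′)
           (x∣ʳy⇒x∣ʳzy t (∙-cong-∣ (rising-∣ L-splitting (suc K) n)
             (∙-cong-∣ ∣-refl (L-∣ (divides k ≡.refl))))))))
    where
    N = suc (suc n)
    K = k ℕ.* N
    r = rising L (suc (suc K)) n
    den′ : rising L 1 (suc n) * L N ≈ rising L 1 n * (L (suc n) * L N)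
    den′ = trans (*-congʳ (rising-last L 1 n)) (*-assoc _ _ _)
    den : rising L 1 (suc n) * L N ≈ rising L 2 (suc n)
    den = begin
      rising L 1 (suc n) * L N ≈⟨ rising-last L 1 (suc n) ⟨
      rising L 1 N             ≈⟨ *-congʳ L-1 ⟩
      1# * rising L 2 (suc n)  ≈⟨ *-identityˡ _ ⟩
      rising L 2 (suc n)       ∎
    num : rising L (suc (suc K)) (suc n) ≈ L (suc K) * r * L N + t * (r * (L (suc n) * L K))
    num = begin
      rising L (suc (suc K)) (suc n)
        ≈⟨ rising-last L (suc (suc K)) n ⟩
      r * L (suc (suc K) ℕ.+ n)
        ≡⟨ ≡.cong (λ i → r * L i) (≡.trans (≡.cong suc (≡.sym (ℕₚ.+-suc K n))) (≡.sym (ℕₚ.+-suc K (suc n)))) ⟩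
      r * L (K ℕ.+ suc (suc n))
        ≈⟨ *-congˡ (L-+ K (suc n)) ⟩
      r * (L (suc K) * L N + t * (L K * L (suc n)))
        ≈⟨ solve 6 (λ r x y z w t → r :* (x :* y :+ t :* (z :* w)) :=
               x :* r :* y :+ t :* (r :* (w :* z)))
             refl r (L (suc K)) (L N) (L K) (L (suc n)) t ⟩
      L (suc K) * r * L N + t * (r * (L (suc n) * L K)) ∎

  Lₑ : ℕ → Carrier
  Lₑ i = L (2 ℕ.* i)

  Lₑ-splitting : Splitting Lₑ
  Lₑ-splitting = splitting-multiples 2 L-splitting

  -- For rank N + 1 and h = 2N, the index `suc K` stands for kN, so M = kh. The factor of the extra
  -- degree N + 1 splits as L(M + 1)L(N + 1) + tL(M)L(N). In the second summand L(M) extends `r`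
  -- downwards to a run of N + 1 terms of `Lₑ`; this is a multiple of `rising Lₑ 1 (suc N)`, whose
  -- last factor L(2(N + 1)) is a multiple of L(N + 1).
  rising-∣-D : ∀ K N → rising Lₑ 1 N * L (suc N) ∣ rising Lₑ (suc (suc K)) N * L (suc N ℕ.+ 2 ℕ.* suc K)
  rising-∣-D K N = ∣-respʳ-≈ (sym num)
    (∣-+ (x∣ʳy⇒x∣ʳzy _ (∙-cong-∣ (rising-∣ Lₑ-splitting (suc K) N) ∣-refl))
         (x∣ʳy⇒x∣ʳzy _ (∣-trans
           (∙-cong-∣ ∣-refl (L-∣ (divides 2 ≡.refl)))
           (∣-respˡ-≈ (rising-last Lₑ 1 N) (rising-∣ Lₑ-splitting K (suc N))))))
    where
    M = 2 ℕ.* suc K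
    r = rising Lₑ (suc (suc K)) N
    num : r * L (suc N ℕ.+ M) ≈ L (suc M) * (r * L (suc N)) + (t * L N) * (L M * r)
    num = begin
      r * L (suc N ℕ.+ M)
        ≡⟨ ≡.cong (λ i → r * L i) (ℕₚ.+-comm (suc N) M) ⟩
      r * L (M ℕ.+ suc N)
        ≈⟨ *-congˡ (L-+ M N) ⟩
      r * (L (suc M) * L (suc N) + t * (L M * L N))
        ≈⟨ solve 6 (λ r x y z w t → r :* (x :* y :+ t :* (z :* w)) :=
               x :* (r :* y) :+ (t :* w) :* (z :* r))
             refl r (L (suc M)) (L (suc N)) (L M) (L N) t ⟩
      L (suc M) * (r * L (suc N)) + (t * L N) * (L M * r) ∎

  even-or-odd : ∀ k → 2 ℕ∣.∣ k ⊎ 2 ℕ∣.∣ suc k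
  even-or-odd zero = inj₁ (divides 0 ≡.refl)
  even-or-odd (suc k) with even-or-odd k
  ... | inj₁ (divides c e) = inj₂ (divides (suc c) (≡.cong (2 ℕ.+_) e))
  ... | inj₂ 2∣1+k         = inj₁ 2∣1+k

  -- Splitting L(K + 2) with K = km gives one summand containing L(2)L(m + K) and one containing
  -- L(K)L(m + K). In the latter the indices are km and (k + 1)m: the one with the even multiplier
  -- yields L(2), the other L(m).
  L-∣-I₂ : ∀ k m → L 2 * L m ∣ L (2 ℕ.+ k ℕ.* m) * L (m ℕ.+ k ℕ.* m)
  L-∣-I₂ k m = ∣-respʳ-≈ (sym num)
    (∣-+ (x∣ʳy⇒x∣ʳzy _ (∙-cong-∣ ∣-refl (L-∣ m∣m+K)))
         (x∣ʳy⇒x∣ʳzy _ (second (even-or-odd k))))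
    where
    K = k ℕ.* m
    m∣m+K : m ℕ∣.∣ m ℕ.+ K
    m∣m+K = divides (suc k) ≡.refl
    second : 2 ℕ∣.∣ k ⊎ 2 ℕ∣.∣ suc k → L 2 * L m ∣ L K * L (m ℕ.+ K)
    second (inj₁ 2∣k)   = ∙-cong-∣ (L-∣ (ℕ∣.∣-trans 2∣k (ℕ∣.m∣m*n m))) (L-∣ m∣m+K)
    second (inj₂ 2∣1+k) = ∣-respʳ-≈ (*-comm _ _)
      (∙-cong-∣ (L-∣ (ℕ∣.∣-trans 2∣1+k (ℕ∣.m∣m*n m))) (L-∣ (divides k ≡.refl)))
    num : L (2 ℕ.+ K) * L (m ℕ.+ K) ≈
          L (suc K) * (L 2 * L (m ℕ.+ K)) + (t * L 1) * (L K * L (m ℕ.+ K))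
    num = begin
      L (2 ℕ.+ K) * L (m ℕ.+ K)
        ≡⟨ ≡.cong (λ i → L i * L (m ℕ.+ K)) (ℕₚ.+-comm 2 K) ⟩
      L (K ℕ.+ 2) * L (m ℕ.+ K)
        ≈⟨ *-congʳ (L-+ K 1) ⟩
      (L (suc K) * L 2 + t * (L K * L 1)) * L (m ℕ.+ K)
        ≈⟨ solve 6 (λ x y z w t v → (x :* y :+ t :* (z :* w)) :* v :=
               x :* (y :* v) :+ (t :* w) :* (z :* v))
             refl (L (suc K)) (L 2) (L K) (L 1) t (L (m ℕ.+ K)) ⟩
      L (suc K) * (L 2 * L (m ℕ.+ K)) + (t * L 1) * (L K * L (m ℕ.+ K)) ∎

  -- The number `h` is a free parameter, so that each family can be proved with its explicit Coxeter
  -- number and then transported to `maxDegree`.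
  Fuss : List ℕ → ℕ → ℕ → Set _
  Fuss ds h k = product (map L ds) ∣ product (map (λ d → L (d ℕ.+ k ℕ.* h)) ds)

  fuss-A : ∀ n k → Fuss (map (ℕ._+ 2) (upTo (suc n))) (suc (suc n)) k
  fuss-A n k = ∣-respˡ-≈ (sym (product-map-upTo L 2 (suc n) λ i → ≡.cong L (ℕₚ.+-comm i 2)))
    (∣-respʳ-≈ (sym (product-map-upTo L (2 ℕ.+ K) (suc n) λ i → ≡.cong L (index i K)))
      (rising-∣-A k n))
    where
    K = k ℕ.* suc (suc n)
    index : ∀ i K → i ℕ.+ 2 ℕ.+ K ≡ 2 ℕ.+ K ℕ.+ i
    index = solve-∀

  -- All indices are even, so both products are runs of n terms of `Lₑ`, starting at 1 and at kn +
  -- 1; the quotient is a generalised binomial coefficient.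
  fuss-B : ∀ n k → Fuss (map (λ i → 2 ℕ.* (i ℕ.+ 1)) (upTo n)) (2 ℕ.* n) k
  fuss-B n k = ∣-respˡ-≈ (sym (product-map-upTo Lₑ 1 n λ i → ≡.cong Lₑ (ℕₚ.+-comm i 1)))
    (∣-respʳ-≈ (sym (product-map-upTo Lₑ (suc (k ℕ.* n)) n λ i → ≡.cong L (index i k n)))
      (rising-∣ Lₑ-splitting (k ℕ.* n) n))
    where
    index : ∀ i k n → 2 ℕ.* (i ℕ.+ 1) ℕ.+ k ℕ.* (2 ℕ.* n) ≡ 2 ℕ.* (1 ℕ.+ k ℕ.* n ℕ.+ i)
    index = solve-∀

  fuss-D : ∀ n k →
    Fuss (map (λ i → 2 ℕ.* (i ℕ.+ 1)) (upTo (suc n)) ++ suc (suc n) ∷ []) (2 ℕ.* suc n) (suc k)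
  fuss-D n k =
    ∣-respˡ-≈ (sym (trans (product-map-∷ʳ L ds (suc (suc n))) (*-congʳ
        (product-map-upTo Lₑ 1 (suc n) λ i → ≡.cong Lₑ (ℕₚ.+-comm i 1)))))
      (∣-respʳ-≈ (sym (trans (product-map-∷ʳ (λ d → L (d ℕ.+ suc k ℕ.* (2 ℕ.* suc n))) ds (suc (suc n))) (*-cong
          (product-map-upTo Lₑ (suc (suc K)) (suc n) λ i → ≡.cong L (index i k n))
          (reflexive (≡.cong L (lastIndex k n))))))
        (rising-∣-D K (suc n)))
    where
    ds = map (λ i → 2 ℕ.* (i ℕ.+ 1)) (upTo (suc n))
    -- This is (k + 1)(n + 1) - 1, so that 2(K + 1) is the shift (k + 1)h.
    K = n ℕ.+ k ℕ.* suc n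
    index : ∀ i k n → 2 ℕ.* (i ℕ.+ 1) ℕ.+ suc k ℕ.* (2 ℕ.* suc n) ≡ 2 ℕ.* (suc (suc (n ℕ.+ k ℕ.* suc n)) ℕ.+ i)
    index = solve-∀
    lastIndex : ∀ k n → suc (suc n) ℕ.+ suc k ℕ.* (2 ℕ.* suc n) ≡ suc (suc n) ℕ.+ 2 ℕ.* suc (n ℕ.+ k ℕ.* suc n)
    lastIndex = solve-∀

  fuss-I₂ : ∀ m k → Fuss (2 ∷ m ∷ []) m k
  fuss-I₂ m k = ∣-respˡ-≈ (*-congˡ (sym (*-identityʳ _)))
    (∣-respʳ-≈ (*-congˡ (sym (*-identityʳ _))) (L-∣-I₂ k m))

  -- Homogenisation, and the exceptional types by computation.

  private
    module × = SemiringMult semiring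
  open SemiringExp semiring using (_^_)

  infixr 8 _•_
  _•_ : ℕ → Carrier → Carrier
  _•_ = ×._×_

  -- The value of Σ aᵢ s^(n - 2i) t^i. Since `n ∸ 2` truncates, the lemmas that change the degree
  -- assume `Fits`; those on sums and scalars hold for every list.
  homogenise : ℕ → UPoly → Carrier
  homogenise n []      = 0#
  homogenise n (a ∷ p) = (a • 1#) * s ^ n + t * homogenise (n ∸ 2) p

  homogenise-+ : ∀ n p q → homogenise n (p +ᵘ q) ≈ homogenise n p + homogenise n q
  homogenise-+ n []      q       = sym (+-identityˡ _)
  homogenise-+ n (a ∷ p) []      = sym (+-identityʳ _)
  homogenise-+ n (a ∷ p) (b ∷ q) = begin
    ((a ℕ.+ b) • 1#) * s ^ n + t * homogenise (n ∸ 2) (p +ᵘ q)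
      ≈⟨ +-cong (*-congʳ (×.×-homo-+ 1# a b)) (*-congˡ (homogenise-+ (n ∸ 2) p q)) ⟩
    (a • 1# + b • 1#) * s ^ n + t * (homogenise (n ∸ 2) p + homogenise (n ∸ 2) q)
      ≈⟨ solve 6 (λ a b s t x y → (a :+ b) :* s :+ t :* (x :+ y) :=
             (a :* s :+ t :* x) :+ (b :* s :+ t :* y))
           refl (a • 1#) (b • 1#) (s ^ n) t (homogenise (n ∸ 2) p) (homogenise (n ∸ 2) q) ⟩
    homogenise n (a ∷ p) + homogenise n (b ∷ q) ∎

  homogenise-scale : ∀ n a p → homogenise n (scaleᵘ a p) ≈ (a • 1#) * homogenise n p
  homogenise-scale n a []      = sym (zeroʳ _)
  homogenise-scale n a (b ∷ p) = begin
    ((a ℕ.* b) • 1#) * s ^ n + t * homogenise (n ∸ 2) (scaleᵘ a p)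
      ≈⟨ +-cong (*-congʳ (×.×1-homo-* a b)) (*-congˡ (homogenise-scale (n ∸ 2) a p)) ⟩
    (a • 1#) * (b • 1#) * s ^ n + t * ((a • 1#) * homogenise (n ∸ 2) p)
      ≈⟨ solve 5 (λ a b s t x → a :* b :* s :+ t :* (a :* x) := a :* (b :* s :+ t :* x))
           refl (a • 1#) (b • 1#) (s ^ n) t (homogenise (n ∸ 2) p) ⟩
    (a • 1#) * homogenise n (b ∷ p) ∎

  homogenise-0∷ : ∀ n p → homogenise n (0 ∷ p) ≈ t * homogenise (n ∸ 2) p
  homogenise-0∷ n p = trans (+-congʳ (zeroˡ _)) (+-identityˡ _)

  homogenise-suc : ∀ {n p} → Fits n p → homogenise (suc n) p ≈ s * homogenise n p
  homogenise-suc [] = sym (zeroʳ s)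
  homogenise-suc {n} ([-] {a = a}) =
    solve 4 (λ a s t x → a :* (s :* x) :+ t :* con 0 := s :* (a :* x :+ t :* con 0))
      refl (a • 1#) s t (s ^ n)
  homogenise-suc {suc (suc n)} {_ ∷ p} (a ∷ f) = begin
    (a • 1#) * (s * s ^ (2 ℕ.+ n)) + t * homogenise (suc n) p
      ≈⟨ +-congˡ (*-congˡ (homogenise-suc f)) ⟩
    (a • 1#) * (s * s ^ (2 ℕ.+ n)) + t * (s * homogenise n p)
      ≈⟨ solve 5 (λ a s t x y → a :* (s :* x) :+ t :* (s :* y) := s :* (a :* x :+ t :* y))
           refl (a • 1#) s t (s ^ (2 ℕ.+ n)) (homogenise n p) ⟩
    s * homogenise (2 ℕ.+ n) (a ∷ p) ∎

  homogenise-shift : ∀ m {n p} → Fits n p → homogenise (m ℕ.+ n) p ≈ s ^ m * homogenise n p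
  homogenise-shift zero    f = sym (*-identityˡ _)
  homogenise-shift (suc m) f = trans (homogenise-suc (fits-mono m f))
    (trans (*-congˡ (homogenise-shift m f)) (sym (*-assoc _ _ _)))

  homogenise-* : ∀ {m n p q} → Fits m p → Fits n q →
    homogenise (m ℕ.+ n) (p *ᵘ q) ≈ homogenise m p * homogenise n q
  homogenise-* {p = []} f g = sym (zeroˡ _)
  homogenise-* {m} {n} {a ∷ p} {q} f g = begin
    homogenise (m ℕ.+ n) (scaleᵘ a q +ᵘ (0 ∷ (p *ᵘ q)))
      ≈⟨ trans (homogenise-+ (m ℕ.+ n) (scaleᵘ a q) _)
           (+-cong (trans (homogenise-scale (m ℕ.+ n) a q) (*-congˡ (homogenise-shift m g)))
                   (trans (homogenise-0∷ (m ℕ.+ n) (p *ᵘ q)) (*-congˡ (tail f)))) ⟩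
    (a • 1#) * (s ^ m * homogenise n q) + t * (homogenise (m ∸ 2) p * homogenise n q)
      ≈⟨ solve 5 (λ a s t x y → a :* (s :* y) :+ t :* (x :* y) := (a :* s :+ t :* x) :* y)
           refl (a • 1#) (s ^ m) t (homogenise (m ∸ 2) p) (homogenise n q) ⟩
    homogenise m (a ∷ p) * homogenise n q ∎
    where
    -- Either `p` is empty and both sides vanish, or `m` is at least 2 and the truncated subtraction
    -- acts on `m` alone.
    tail : ∀ {m p} → Fits m (a ∷ p) →
      homogenise (m ℕ.+ n ∸ 2) (p *ᵘ q) ≈ homogenise (m ∸ 2) p * homogenise n q
    tail [-]      = sym (zeroˡ _)
    tail (_ ∷ f′) = homogenise-* f′ g

  L-homogenise : ∀ n → L n ≈ homogenise (pred n) (lucas₁ n)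
  L-homogenise zero = L-0
  L-homogenise (suc zero) = trans L-1
    (solve 1 (λ t → con 1 := (con 1 :+ con 0) :* con 1 :+ t :* con 0) refl t)
  L-homogenise (suc (suc zero)) = begin
    L 2                 ≈⟨ L-rec 0 ⟩
    s * L 1 + t * L 0   ≈⟨ +-cong (*-congˡ L-1) (*-congˡ L-0) ⟩
    s * 1# + t * 0#
      ≈⟨ solve 2 (λ s t → s :* con 1 :+ t :* con 0 :=
             (con 1 :+ con 0) :* (s :* con 1) :+ t :* con 0) refl s t ⟩
    homogenise 1 (lucas₁ 2) ∎
  L-homogenise (suc (suc (suc n))) = begin
    L (3 ℕ.+ n)
      ≈⟨ L-rec (suc n) ⟩
    s * L (2 ℕ.+ n) + t * L (suc n)
      ≈⟨ +-cong (*-congˡ (L-homogenise (suc (suc n)))) (*-congˡ (L-homogenise (suc n))) ⟩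
    s * homogenise (suc n) (lucas₁ (2 ℕ.+ n)) + t * homogenise n (lucas₁ (suc n))
      ≈⟨ +-cong (homogenise-suc (fits-lucas₁ (2 ℕ.+ n))) (homogenise-0∷ (2 ℕ.+ n) (lucas₁ (suc n))) ⟨
    homogenise (2 ℕ.+ n) (lucas₁ (2 ℕ.+ n)) + homogenise (2 ℕ.+ n) (0 ∷ lucas₁ (suc n))
      ≈⟨ homogenise-+ (2 ℕ.+ n) (lucas₁ (2 ℕ.+ n)) (0 ∷ lucas₁ (suc n)) ⟨
    homogenise (2 ℕ.+ n) (lucas₁ (3 ℕ.+ n)) ∎

  product-homogenise : ∀ ns → product (map L ns) ≈ homogenise (degree ns) (lucasProduct₁ ns)
  product-homogenise [] =
    solve 1 (λ t → con 1 := (con 1 :+ con 0) :* con 1 :+ t :* con 0) refl t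
  product-homogenise (n ∷ ns) rewrite lucasFrom-0 n = begin
    L n * product (map L ns)
      ≈⟨ *-cong (L-homogenise n) (product-homogenise ns) ⟩
    homogenise (pred n) (lucas₁ n) * homogenise (degree ns) (lucasProduct₁ ns)
      ≈⟨ homogenise-* (fits-lucas₁ n) (fits-lucasProduct₁ ns) ⟨
    homogenise (pred n ℕ.+ degree ns) (lucas₁ n *ᵘ lucasProduct₁ ns) ∎

  -- Homogenising the identity checked at s = 1 restores the powers of s: the quotient fits the
  -- difference of the degrees, so homogenisation is multiplicative here.
  certificate⇒∣ : ∀ ds ns → Certificate ds ns → product (map L ds) ∣ product (map L ns)
  certificate⇒∣ ds ns (k+m≡n , fits , q*d≡p) = homogenise k q , (begin
    homogenise k q * product (map L ds)
      ≈⟨ *-congˡ (product-homogenise ds) ⟩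
    homogenise k q * homogenise (degree ds) (lucasProduct₁ ds)
      ≈⟨ homogenise-* fits (fits-lucasProduct₁ ds) ⟨
    homogenise (k ℕ.+ degree ds) (q *ᵘ lucasProduct₁ ds)
      ≡⟨ ≡.cong₂ homogenise k+m≡n q*d≡p ⟩
    homogenise (degree ns) (lucasProduct₁ ns)
      ≈⟨ product-homogenise ns ⟨
    product (map L ns) ∎)
    where
    k = degree ns ∸ degree ds
    q = quotient (lucasProduct₁ ns) (lucasProduct₁ ds)

  -- The product over the gcds lies between the two sides. The certificate for r = k mod m gives the
  -- first divisibility. The second holds factor by factor through `L-∣`, as d + kh exceeds d + rh
  -- by a multiple of mh.
  certifiedModulo⇒fuss : ∀ ds h m .{{_ : NonZero m}} → CertifiedModulo ds h m → ∀ k → Fuss ds h k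
  certifiedModulo⇒fuss ds h m certified k = ∣-trans
    (certificate⇒∣ ds (commonDivisors ds h m r) (All.lookup certified (∈-upTo⁺ (m%n<n k m))))
    (∣-respˡ-≈ (reflexive (≡.cong product (map-∘ ds)))
      (product-∣ {f = λ d → L (gcd (d ℕ.+ r ℕ.* h) (m ℕ.* h))} {g = λ d → L (d ℕ.+ k ℕ.* h)}
        (λ d → L-∣ (gcd∣ d)) ds))
    where
    r = k % m
    regroup : ∀ d r h c m → d ℕ.+ r ℕ.* h ℕ.+ c ℕ.* (m ℕ.* h) ≡ d ℕ.+ (r ℕ.+ c ℕ.* m) ℕ.* h
    regroup = solve-∀
    index : ∀ d → d ℕ.+ r ℕ.* h ℕ.+ (k / m) ℕ.* (m ℕ.* h) ≡ d ℕ.+ k ℕ.* h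
    index d = ≡.trans (regroup d r h (k / m) m)
      (≡.cong (λ x → d ℕ.+ x ℕ.* h) (≡.sym (m≡m%n+[m/n]*n k m)))
    gcd∣ : ∀ d → gcd (d ℕ.+ r ℕ.* h) (m ℕ.* h) ℕ∣.∣ d ℕ.+ k ℕ.* h
    gcd∣ d = ≡.subst (gcd (d ℕ.+ r ℕ.* h) (m ℕ.* h) ℕ∣.∣_) (index d)
      (ℕ∣.∣m∣n⇒∣m+n (gcd[m,n]∣m (d ℕ.+ r ℕ.* h) (m ℕ.* h))
        (ℕ∣.∣n⇒∣m*n (k / m) (gcd[m,n]∣n (d ℕ.+ r ℕ.* h) (m ℕ.* h))))

  -- For a concrete type and modulus the hidden argument is found by running the decision procedure;
  -- this is where the finite computation takes place.
  sporadic : ∀ W m .{{_ : NonZero m}} {_ : True (certifiedModulo? (degrees W) (maxDegree W) m)} →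
    ∀ k → Fuss (degrees W) (maxDegree W) k
  sporadic W m {certified} = certifiedModulo⇒fuss (degrees W) (maxDegree W) m (toWitness certified)

  fuss : ∀ W k → 1 ≤ k → Fuss (degrees W) (maxDegree W) k
  fuss (A (suc n) 1≤n) k _ =
    ≡.subst (λ h → Fuss (degrees (A (suc n) 1≤n)) h k) (≡.sym (maxDegree-A n {1≤n})) (fuss-A n k)
  fuss (B (suc n) 2≤n) k _ =
    ≡.subst (λ h → Fuss (degrees (B (suc n) 2≤n)) h k) (≡.sym (maxDegree-B n {2≤n})) (fuss-B (suc n) k)
  -- Opening the rank bound rules out rank 1, and k ≥ 1 supplies the form `suc k` that `fuss-D`
  -- expects.
  fuss (D (suc (suc n)) 4≤n@(s≤s (s≤s _))) (suc k) _ =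
    ≡.subst (λ h → Fuss (degrees (D (suc (suc n)) 4≤n)) h (suc k)) (≡.sym (maxDegree-D n {4≤n})) (fuss-D n k)
  fuss (I₂ m 3≤m) k _ =
    ≡.subst (λ h → Fuss (degrees (I₂ m 3≤m)) h k) (≡.sym (maxDegree-I₂ 3≤m)) (fuss-I₂ m k)
  -- The moduli are the lcm over the degrees d of d / gcd(d, h).
  fuss E6 k _ = sporadic E6 30 k
  fuss E7 k _ = sporadic E7 140 k
  fuss E8 k _ = sporadic E8 84 k
  fuss F4 k _ = sporadic F4 2 k
  fuss H3 k _ = sporadic H3 3 k
  fuss H4 k _ = sporadic H4 2 k

-- The Lucas polynomials in ℕ[s,t].

lucas-isLucasSequence : IsLucasSequence ℕ[s,t].commutativeSemiring 𝐬 𝐭 lucas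
lucas-isLucasSequence = record
  { L-0   = ℕ[s,t].≋-refl
  ; L-1   = ℕ[s,t].≋-refl
  ; L-rec = λ n → ℕ[s,t].⊕-cong (mulS≋𝐬* (lucas (suc n))) (mulT≋𝐭* (lucas n))
  }

theorem3p4 : (W : CoxeterType) (k : ℕ) → 1 ≤ k →
    ∃ λ (P : Poly) → (P *ᵖ catDen W) ≈ᵖ catNum W k
theorem3p4 W k 1≤k with P RawMagma., P*den≋num ← LucasSequence.fuss ℕ[s,t].commutativeSemiring 𝐬 𝐭 lucas
  lucas-isLucasSequence W k 1≤k = P , ≋⇒≈ᵖ P*den≋num
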